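{- If $p,q>1$ are coprime integers, then $g(Q_{\{p,q\}}(x))=\min\{p,q\}-1$.
   Context: For coprime integers $p,q>1$, $Q_{\{p,q\}}(x)=\dfrac{(x^{pq}-1)(x-1)}{(x^p-1)(x^q-1)}$, which is a polynomial with integer coefficients (the binary inclusion-exclusion polynomial). For a nonzero polynomial $f=c_1x^{e_1}+\cdots+c_sx^{e_s}$ with all coefficients $c_i$ non-zero and $e_1<e_2<\cdots<e_s$, the maximum gap of $f$ is $g(f)=\max_{1\le i<s}(e_{i+1}-e_i)$, with $g(f)=0$ when $s=1$. -}

module Defs where

open import Data.Integer.Base as ℤ using (ℤ; 0ℤ; 1ℤ)
open import Data.Integer.Properties using (_≟_)
open import Data.List.Base using (List; []; _∷_; [_]; _++_; map; replicate; filter; upTo; length; zipWith; drop; foldr)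
open import Data.Nat.Base as ℕ using (ℕ; zero; suc; _∸_; _⊔_)
open import Relation.Binary.PropositionalEquality.Core using (_≡_)
open import Relation.Nullary.Decidable using (¬?)

infixl 6 _+_ _-_
infixl 7 _*_
infix  4 _≈_

-- Coefficient lists, constant term first.  Trailing zeros are allowed, so
-- equality of polynomials is _≈_ rather than _≡_.
ℤ[x] : Set
ℤ[x] = List ℤ

coeff : ℤ[x] → ℕ → ℤ
coeff []      _       = 0ℤ
coeff (a ∷ f) zero    = a
coeff (a ∷ f) (suc n) = coeff f n

_≈_ : ℤ[x] → ℤ[x] → Set
f ≈ g = ∀ n → coeff f n ≡ coeff g n

_+_ : ℤ[x] → ℤ[x] → ℤ[x]
[]      + g       = g
(a ∷ f) + []      = a ∷ f
(a ∷ f) + (b ∷ g) = a ℤ.+ b ∷ f + g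

_-_ : ℤ[x] → ℤ[x] → ℤ[x]
f - g = f + map ℤ.-_ g

_*_ : ℤ[x] → ℤ[x] → ℤ[x]
[]      * g = []
(a ∷ f) * g = map (a ℤ.*_) g + (0ℤ ∷ f * g)

x^_ : ℕ → ℤ[x]
x^ n = replicate n 0ℤ ++ [ 1ℤ ]

𝟙 : ℤ[x]
𝟙 = [ 1ℤ ]

-- Q = (x^{pq} - 1)(x - 1) / ((x^p - 1)(x^q - 1)), with the denominator cleared.
-- For p, q > 0 the denominator is nonzero and ℤ[x] is an integral domain, so
-- this determines Q up to _≈_.
IsBinaryInclusionExclusion : ℕ → ℕ → ℤ[x] → Set
IsBinaryInclusionExclusion p q Q =
  Q * ((x^ p - 𝟙) * (x^ q - 𝟙)) ≈ (x^ (p ℕ.* q) - 𝟙) * (x^ 1 - 𝟙)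

-- The exponents e₁ < ⋯ < eₛ carrying a nonzero coefficient, in this order.
exponents : ℤ[x] → List ℕ
exponents f = filter (λ n → ¬? (coeff f n ≟ 0ℤ)) (upTo (length f))

gaps : List ℕ → List ℕ
gaps es = zipWith (λ e e′ → e′ ∸ e) es (drop 1 es)

-- With a single exponent there are no gaps and the maximum is 0.  The zero
-- polynomial, where the maximum gap is not defined, is also sent to 0.
maxGap : ℤ[x] → ℕ
maxGap f = foldr _⊔_ 0 (gaps (exponents f))

{-# OPTIONS --safe #-}
module Submission where

-- Dividing x^(pq) − 1 = (x^p − 1)(1 + x^p + ⋯ + x^((q−1)p)) by x^q − 1 shows that
-- Q = (1 − x) Σ x^s, the sum being over the numerical semigroup S = ⟨p , q⟩, so the
-- exponents of Q are the n at which membership in S changes.  Let r = min (p , q).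
-- Since S is closed under adding r, any r consecutive integers meet S, and r
-- consecutive elements of S are followed by elements of S only; so every gap is at
-- most r − 1.  The gap r − 1 occurs between 1 and r, because 0 and r lie in S and
-- 1 , … , r − 1 do not.

open import Defs using (ℤ[x]; IsBinaryInclusionExclusion; maxGap; coeff; _≈_; x^_; 𝟙; exponents; gaps)
import Defs as P
open import Data.Integer.Base as ℤ using (ℤ; 0ℤ; -1ℤ; _+_; _-_; _*_; -_)
import Data.Integer.Properties as ℤ
open import Algebra.Properties.AbelianGroup ℤ.+-0-abelianGroup using (∙-cancelˡ)
import Data.Integer.Tactic.RingSolver as ℤ-Solver
open import Data.List.Base using ([]; _∷_; map; foldr; upTo; length; applyUpTo)
open import Data.List.Membership.Propositional using (_∈_)
open import Data.List.Membership.Propositional.Properties using (∈-filter⁺; ∈-filter⁻; ∈-upTo⁺)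
open import Data.List.Relation.Unary.All as All using ([]; _∷_)
open import Data.List.Relation.Unary.AllPairs using (AllPairs; []; _∷_)
import Data.List.Relation.Unary.AllPairs.Properties as AllPairs
open import Data.List.Relation.Unary.Any using (here; there)
open import Data.Nat.Base as ℕ using (ℕ; zero; suc; _<_; _≤_; _⊓_; _⊔_; _∸_; z≤n; s≤s; NonZero)
open import Data.Nat.Coprimality using (Coprime; coprime-divisor; coprime-Bézout)
import Data.Nat.Coprimality as Coprimality
open import Data.Nat.Divisibility using (_∣_; divides; _∣?_; ∣m+n∣m⇒∣n; ∣m∣n⇒∣m+n; ∣-refl; >⇒∤; n∣m*n)
open import Data.Nat.DivMod using (_/_; _%_; m≡m%n+[m/n]*n; m%n<n)
open import Data.Nat.GCD using (module Bézout)
open import Data.Nat.Induction using (<-rec)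
import Data.Nat.Properties as ℕ
import Data.Nat.Tactic.RingSolver as ℕ-Solver
open import Data.Product.Base using (∃; ∃₂; _×_; _,_; proj₁; proj₂)
open import Data.Sum.Base using (_⊎_; inj₁; inj₂)
open import Function.Base using (_∘_; id)
open import Relation.Binary.PropositionalEquality
open import Relation.Nullary.Decidable using (¬?; yes; no)
open import Relation.Nullary.Negation using (¬_; contradiction)

-- Power series

-- Multiplication by x^k. Power series are coefficient functions, so 1 / (x^q - 1) can be treated
-- alongside polynomials.
shift : ℕ → (ℕ → ℤ) → ℕ → ℤ
shift zero    f n       = f n
shift (suc k) f zero    = 0ℤ
shift (suc k) f (suc n) = shift k f n

shift-cong : ∀ k {f g} → f ≗ g → shift k f ≗ shift k g
shift-cong zero    f≗g n       = f≗g n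
shift-cong (suc k) f≗g zero    = refl
shift-cong (suc k) f≗g (suc n) = shift-cong k f≗g n

-- One statement serves sums, differences, scalar multiples and the zero series; `0ℤ ∙ 0ℤ ≡ 0ℤ`
-- handles the k leading zeros.
shift-zipWith : ∀ (_∙_ : ℤ → ℤ → ℤ) → 0ℤ ∙ 0ℤ ≡ 0ℤ → ∀ k f g →
                shift k (λ n → f n ∙ g n) ≗ λ n → shift k f n ∙ shift k g n
shift-zipWith _∙_ 0∙0 zero    f g n       = refl
shift-zipWith _∙_ 0∙0 (suc k) f g zero    = sym 0∙0
shift-zipWith _∙_ 0∙0 (suc k) f g (suc n) = shift-zipWith _∙_ 0∙0 k f g n

shift-shift : ∀ j k f → shift j (shift k f) ≗ shift (j ℕ.+ k) f
shift-shift zero    k f n       = refl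
shift-shift (suc j) k f zero    = refl
shift-shift (suc j) k f (suc n) = shift-shift j k f n

shift-comm : ∀ j k f → shift j (shift k f) ≗ shift k (shift j f)
shift-comm j k f n = begin
  shift j (shift k f) n  ≡⟨ shift-shift j k f n ⟩
  shift (j ℕ.+ k) f n    ≡⟨ cong (λ i → shift i f n) (ℕ.+-comm j k) ⟩
  shift (k ℕ.+ j) f n    ≡⟨ shift-shift k j f n ⟨
  shift k (shift j f) n  ∎
  where open ≡-Reasoning

shift-< : ∀ {k n} f → n < k → shift k f n ≡ 0ℤ
shift-< {suc k} {zero}  f _         = refl
shift-< {suc k} {suc n} f (s≤s n<k) = shift-< f n<k

shift-+ : ∀ k n f → shift k f (k ℕ.+ n) ≡ f n
shift-+ zero    n f = refl
shift-+ (suc k) n f = shift-+ k n f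

-- A positive shift reads only earlier coefficients; this feeds the strong induction in
-- `Δ-injective`.
shift-suc-local : ∀ k {f g} n → (∀ {m} → m < n → f m ≡ g m) →
                  shift (suc k) f n ≡ shift (suc k) g n
shift-suc-local k       zero    f≡g = refl
shift-suc-local zero    (suc n) f≡g = f≡g ℕ.≤-refl
shift-suc-local (suc k) (suc n) f≡g = shift-suc-local k n (f≡g ∘ ℕ.m<n⇒m<1+n)

-- Multiplication of a power series by x^k − 1.
Δ : ℕ → (ℕ → ℤ) → ℕ → ℤ
Δ k f n = shift k f n - f n

Δ-cong : ∀ k {f g} → f ≗ g → Δ k f ≗ Δ k g
Δ-cong k f≗g n = cong₂ _-_ (shift-cong k f≗g n) (f≗g n)

shift-Δ : ∀ j k f → shift j (Δ k f) ≗ Δ k (shift j f)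
shift-Δ j k f n = begin
  shift j (Δ k f) n                    ≡⟨ shift-zipWith _-_ refl j (shift k f) f n ⟩
  shift j (shift k f) n - shift j f n  ≡⟨ cong (_- shift j f n) (shift-comm j k f n) ⟩
  Δ k (shift j f) n                    ∎
  where open ≡-Reasoning

Δ-0 : ∀ k → Δ k (λ _ → 0ℤ) ≗ λ _ → 0ℤ
Δ-0 k n = cong (_- 0ℤ) (shift-zipWith (λ _ _ → 0ℤ) refl k (λ _ → 0ℤ) (λ _ → 0ℤ) n)

Δ-+ : ∀ k f g → Δ k (λ n → f n + g n) ≗ λ n → Δ k f n + Δ k g n
Δ-+ k f g n = begin
  shift k (λ n → f n + g n) n - (f n + g n)    ≡⟨ cong (_- (f n + g n)) (shift-zipWith _+_ refl k f g n) ⟩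
  shift k f n + shift k g n - (f n + g n)      ≡⟨ regroup (shift k f n) (shift k g n) (f n) (g n) ⟩
  Δ k f n + Δ k g n                            ∎
  where
  open ≡-Reasoning
  regroup : ∀ x y u v → x + y - (u + v) ≡ (x - u) + (y - v)
  regroup = ℤ-Solver.solve-∀

Δ-* : ∀ k a f → Δ k (λ n → a * f n) ≗ λ n → a * Δ k f n
Δ-* k a f n = begin
  shift k (λ n → a * f n) n - a * f n    ≡⟨ cong (_- a * f n) (shift-zipWith (λ x _ → a * x) (ℤ.*-zeroʳ a) k f f n) ⟩
  a * shift k f n - a * f n              ≡⟨ regroup a (shift k f n) (f n) ⟩
  a * Δ k f n                            ∎
  where
  open ≡-Reasoning
  regroup : ∀ a x u → a * x - a * u ≡ a * (x - u)
  regroup = ℤ-Solver.solve-∀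

Δ-comm : ∀ j k f → Δ j (Δ k f) ≗ Δ k (Δ j f)
Δ-comm j k f n = begin
  shift j (Δ k f) n - (shift k f n - f n)
    ≡⟨ cong (_- (shift k f n - f n)) (shift-Δ j k f n) ⟩
  shift k (shift j f) n - shift j f n - (shift k f n - f n)
    ≡⟨ regroup (shift k (shift j f) n) (shift j f n) (shift k f n) (f n) ⟩
  shift k (shift j f) n - shift k f n - (shift j f n - f n)
    ≡⟨ cong (_- (shift j f n - f n)) (shift-zipWith _-_ refl k (shift j f) f n) ⟨
  Δ k (Δ j f) n ∎
  where
  open ≡-Reasoning
  regroup : ∀ a b c d → a - b - (c - d) ≡ a - c - (b - d)
  regroup = ℤ-Solver.solve-∀

-- As k > 0, coefficient n of `Δ k f` is - f n plus 0 or an earlier coefficient of f. So f is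
-- recovered recursively, and x^k - 1 can be cancelled.
Δ-injective : ∀ k .{{_ : NonZero k}} {f g} → Δ k f ≗ Δ k g → f ≗ g
Δ-injective (suc k) {f} {g} Δf≗Δg = <-rec _ λ n f≡g →
  ℤ.neg-injective (∙-cancelˡ (shift (suc k) f n) _ _
    (trans (Δf≗Δg n) (cong (_- g n) (sym (shift-suc-local k n f≡g)))))

-- Coefficients of products

coeff-+ : ∀ f g n → coeff (f P.+ g) n ≡ coeff f n + coeff g n
coeff-+ []      g       n       = sym (ℤ.+-identityˡ _)
coeff-+ (a ∷ f) []      n       = sym (ℤ.+-identityʳ _)
coeff-+ (a ∷ f) (b ∷ g) zero    = refl
coeff-+ (a ∷ f) (b ∷ g) (suc n) = coeff-+ f g n

coeff-map : ∀ {h : ℤ → ℤ} → h 0ℤ ≡ 0ℤ → ∀ f n → coeff (map h f) n ≡ h (coeff f n)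
coeff-map h0 []      n       = sym h0
coeff-map h0 (a ∷ f) zero    = refl
coeff-map h0 (a ∷ f) (suc n) = coeff-map h0 f n

coeff-0∷ : ∀ f → coeff (0ℤ ∷ f) ≗ shift 1 (coeff f)
coeff-0∷ f zero    = refl
coeff-0∷ f (suc n) = refl

coeff-∷* : ∀ a f g n → coeff ((a ∷ f) P.* g) n ≡ a * coeff g n + shift 1 (coeff (f P.* g)) n
coeff-∷* a f g n = trans (coeff-+ (map (a *_) g) (0ℤ ∷ f P.* g) n)
  (cong₂ _+_ (coeff-map (ℤ.*-zeroʳ a) g n) (coeff-0∷ (f P.* g) n))

coeff-x^ : ∀ k → coeff (x^ k) ≗ shift k (coeff 𝟙)
coeff-x^ zero    n       = refl
coeff-x^ (suc k) zero    = refl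
coeff-x^ (suc k) (suc n) = coeff-x^ k n

coeff-x^-𝟙 : ∀ k → coeff (x^ k P.- 𝟙) ≗ Δ k (coeff 𝟙)
coeff-x^-𝟙 k n = trans (coeff-+ (x^ k) (map -_ 𝟙) n) (cong₂ _+_ (coeff-x^ k n) (coeff-map {h = -_} refl 𝟙 n))

*-identityʳ : ∀ f → f P.* 𝟙 ≈ f
*-identityʳ []      n       = refl
*-identityʳ (a ∷ f) zero    = trans (ℤ.+-identityʳ _) (ℤ.*-identityʳ a)
*-identityʳ (a ∷ f) (suc n) = *-identityʳ f n

-- The product recurses on its left factor, so x^k - 1 is moved out of the right factor by induction
-- on f: `Δ k` is linear and commutes with multiplication by x.
*-Δ : ∀ k f {g h} → coeff g ≗ Δ k (coeff h) → coeff (f P.* g) ≗ Δ k (coeff (f P.* h))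
*-Δ k []      _    n = sym (Δ-0 k n)
*-Δ k (a ∷ f) {g} {h} g≗Δh n = begin
  coeff ((a ∷ f) P.* g) n
    ≡⟨ coeff-∷* a f g n ⟩
  a * coeff g n + shift 1 (coeff (f P.* g)) n
    ≡⟨ cong₂ (λ x y → a * x + y) (g≗Δh n)
         (trans (shift-cong 1 (*-Δ k f g≗Δh) n) (shift-Δ 1 k (coeff (f P.* h)) n)) ⟩
  a * Δ k (coeff h) n + Δ k (shift 1 (coeff (f P.* h))) n
    ≡⟨ cong (_+ Δ k (shift 1 (coeff (f P.* h))) n) (Δ-* k a (coeff h) n) ⟨
  Δ k (λ m → a * coeff h m) n + Δ k (shift 1 (coeff (f P.* h))) n
    ≡⟨ Δ-+ k (λ m → a * coeff h m) (shift 1 (coeff (f P.* h))) n ⟨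
  Δ k (λ m → a * coeff h m + shift 1 (coeff (f P.* h)) m) n
    ≡⟨ Δ-cong k (coeff-∷* a f h) n ⟨
  Δ k (coeff ((a ∷ f) P.* h)) n ∎
  where open ≡-Reasoning

*-[x^-𝟙] : ∀ k f → coeff (f P.* (x^ k P.- 𝟙)) ≗ Δ k (coeff f)
*-[x^-𝟙] k f n = trans (*-Δ k f (coeff-x^-𝟙 k) n) (Δ-cong k (*-identityʳ f) n)

isBinaryInclusionExclusion-lhs : ∀ p q Q → coeff (Q P.* ((x^ p P.- 𝟙) P.* (x^ q P.- 𝟙))) ≗ Δ q (Δ p (coeff Q))
isBinaryInclusionExclusion-lhs p q Q n =
  trans (*-Δ q Q (*-[x^-𝟙] q (x^ p P.- 𝟙)) n) (Δ-cong q (*-[x^-𝟙] p Q) n)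

isBinaryInclusionExclusion-rhs : ∀ k → coeff ((x^ k P.- 𝟙) P.* (x^ 1 P.- 𝟙)) ≗ Δ 1 (Δ k (coeff 𝟙))
isBinaryInclusionExclusion-rhs k n =
  trans (*-[x^-𝟙] 1 (x^ k P.- 𝟙) n) (Δ-cong 1 (coeff-x^-𝟙 k) n)

-- The semigroup series

infix 4 _≡−[_]

-- The value is -1 times the indicator of A. A proof or refutation of A is kept beside it, so
-- membership can be read off a coefficient.
_≡−[_] : ℤ → Set → Set
z ≡−[ A ] = (A × z ≡ -1ℤ) ⊎ (¬ A × z ≡ 0ℤ)

module _ {A : Set} {x : ℤ} where

  ≡−[]-true : x ≡−[ A ] → A → x ≡ -1ℤ
  ≡−[]-true (inj₁ (_ , x≡-1)) _ = x≡-1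
  ≡−[]-true (inj₂ (¬a , _))   a = contradiction a ¬a

  ≡−[]-true⁻¹ : x ≡−[ A ] → x ≡ -1ℤ → A
  ≡−[]-true⁻¹ (inj₁ (a , _))    _  = a
  ≡−[]-true⁻¹ (inj₂ (_ , refl)) ()

  ≡−[]-false : x ≡−[ A ] → ¬ A → x ≡ 0ℤ
  ≡−[]-false (inj₁ (a , _))  ¬a = contradiction a ¬a
  ≡−[]-false (inj₂ (_ , x≡0)) _ = x≡0

  ≡−[]-map : ∀ {B : Set} → (A → B) → (B → A) → x ≡−[ A ] → x ≡−[ B ]
  ≡−[]-map f g (inj₁ (a , eq))  = inj₁ (f a , eq)
  ≡−[]-map f g (inj₂ (¬a , eq)) = inj₂ (¬a ∘ g , eq)

  -- Disjointness rules out the value -2.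
  ≡−[]-⊎ : ∀ {B : Set} {y} → ¬ (A × B) → x ≡−[ A ] → y ≡−[ B ] → x + y ≡−[ A ⊎ B ]
  ≡−[]-⊎ ¬ab (inj₁ (a , _))     (inj₁ (b , _))     = contradiction (a , b) ¬ab
  ≡−[]-⊎ ¬ab (inj₁ (a , refl))  (inj₂ (_ , refl))  = inj₁ (inj₁ a , refl)
  ≡−[]-⊎ ¬ab (inj₂ (_ , refl))  (inj₁ (b , refl))  = inj₁ (inj₂ b , refl)
  ≡−[]-⊎ ¬ab (inj₂ (¬a , refl)) (inj₂ (¬b , refl)) = inj₂ ((λ { (inj₁ a) → ¬a a ; (inj₂ b) → ¬b b }) , refl)

-- The power series 1 / (x^q − 1).
1/[x^_-1] : ℕ → ℕ → ℤ
1/[x^ q -1] n with q ∣? n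
... | yes _ = -1ℤ
... | no  _ = 0ℤ

1/[x^-1]-spec : ∀ q n → 1/[x^ q -1] n ≡−[ q ∣ n ]
1/[x^-1]-spec q n with q ∣? n
... | yes q∣n = inj₁ (q∣n , refl)
... | no  q∤n = inj₂ (q∤n , refl)

≡−[]-unique : ∀ {A : Set} {x y} → x ≡−[ A ] → y ≡−[ A ] → x ≡ y
≡−[]-unique (inj₁ (a , x≡-1)) y≡ = trans x≡-1 (sym (≡−[]-true y≡ a))
≡−[]-unique (inj₂ (¬a , x≡0)) y≡ = trans x≡0 (sym (≡−[]-false y≡ ¬a))

-- Below q the only multiple of q is 0, which gives 0 - (-1) = 1. From q on, q divides q + m exactly
-- when it divides m, so the two terms cancel.
Δ-1/[x^-1] : ∀ q .{{_ : NonZero q}} → Δ q 1/[x^ q -1] ≗ coeff 𝟙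
Δ-1/[x^-1] q@(suc _) n with n ℕ.<? q
Δ-1/[x^-1] q@(suc _) zero    | yes _   = cong (λ x → 0ℤ - x) (≡−[]-true (1/[x^-1]-spec q 0) (divides 0 refl))
Δ-1/[x^-1] q@(suc _) (suc n) | yes n<q = cong₂ _-_ (shift-< {q} {suc n} 1/[x^ q -1] n<q)
  (≡−[]-false (1/[x^-1]-spec q (suc n)) (>⇒∤ n<q))
Δ-1/[x^-1] q@(suc _) n       | no  n≮q with ℕ.m≤n⇒∃[o]m+o≡n (ℕ.≮⇒≥ n≮q)
... | m , refl = trans (cong (_- 1/[x^ q -1] (q ℕ.+ m))
  (trans (shift-+ q m 1/[x^ q -1])
    (≡−[]-unique (≡−[]-map (∣m∣n⇒∣m+n ∣-refl) (λ d → ∣m+n∣m⇒∣n d ∣-refl) (1/[x^-1]-spec q m))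
      (1/[x^-1]-spec q (q ℕ.+ m))))) (ℤ.+-inverseʳ (1/[x^ q -1] (q ℕ.+ m)))

-- (1 + x^p + ⋯ + x^((m−1)p)) / (x^q − 1), which for m = q is
-- (x^(pq) − 1) / ((x^p − 1) (x^q − 1)).
geometric : (p q m : ℕ) → ℕ → ℤ
geometric p q zero    n = 0ℤ
geometric p q (suc m) n = shift (m ℕ.* p) 1/[x^ q -1] n + geometric p q m n

-- Multiplication by (x^p - 1)(x^q - 1) turns the summand x^(mp) / (x^q - 1) into x^((m+1)p) -
-- x^(mp), and the sum telescopes.
Δ-Δ-geometric : ∀ p q .{{_ : NonZero q}} m → Δ p (Δ q (geometric p q m)) ≗ Δ (m ℕ.* p) (coeff 𝟙)
Δ-Δ-geometric p q zero n = trans (trans (Δ-cong p (Δ-0 q) n) (Δ-0 p n)) (sym (ℤ.+-inverseʳ (coeff 𝟙 n)))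
Δ-Δ-geometric p q (suc m) n = begin
  Δ p (Δ q (geometric p q (suc m))) n
    ≡⟨ Δ-cong p (Δ-+ q (shift mp 1/[x^ q -1]) (geometric p q m)) n ⟩
  Δ p (λ i → Δ q (shift mp 1/[x^ q -1]) i + Δ q (geometric p q m) i) n
    ≡⟨ Δ-+ p (Δ q (shift mp 1/[x^ q -1])) (Δ q (geometric p q m)) n ⟩
  Δ p (Δ q (shift mp 1/[x^ q -1])) n + Δ p (Δ q (geometric p q m)) n
    ≡⟨ cong₂ _+_ (Δ-cong p (λ i → trans (sym (shift-Δ mp q 1/[x^ q -1] i)) (shift-cong mp (Δ-1/[x^-1] q) i)) n)
         (Δ-Δ-geometric p q m n) ⟩
  shift p (shift mp δ) n - shift mp δ n + (shift mp δ n - δ n)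
    ≡⟨ telescope (shift p (shift mp δ) n) (shift mp δ n) (δ n) ⟩
  shift p (shift mp δ) n - δ n
    ≡⟨ cong (_- δ n) (shift-shift p mp δ n) ⟩
  Δ (suc m ℕ.* p) δ n ∎
  where
  open ≡-Reasoning
  mp = m ℕ.* p
  δ = coeff 𝟙
  telescope : ∀ x y z → x - y + (y - z) ≡ x - z
  telescope = ℤ-Solver.solve-∀

Representable : (p q : ℕ) → ℕ → Set
Representable p q n = ∃₂ λ a b → a ℕ.* p ℕ.+ b ℕ.* q ≡ n

-- The support of `geometric p q m` for coprime p, q and m ≤ q: each summand of that series fixes
-- one value of a.
RepresentableBelow : (p q m : ℕ) → ℕ → Set
RepresentableBelow p q m n = ∃₂ λ a b → a < m × a ℕ.* p ℕ.+ b ℕ.* q ≡ n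

shift-1/[x^-1]-spec : ∀ q k n → shift k 1/[x^ q -1] n ≡−[ ∃ (λ b → k ℕ.+ b ℕ.* q ≡ n) ]
shift-1/[x^-1]-spec q k n with n ℕ.<? k
... | yes n<k = inj₂ ((λ { (b , refl) → ℕ.m+n≮m k (b ℕ.* q) n<k }) , shift-< 1/[x^ q -1] n<k)
... | no  n≮k with ℕ.m≤n⇒∃[o]m+o≡n (ℕ.≮⇒≥ n≮k)
...   | m , refl = subst (_≡−[ ∃ (λ b → k ℕ.+ b ℕ.* q ≡ k ℕ.+ m) ]) (sym (shift-+ k m 1/[x^ q -1]))
  (≡−[]-map (λ { (divides b eq) → b , cong (k ℕ.+_) (sym eq) })
            (λ { (b , eq) → divides b (sym (ℕ.+-cancelˡ-≡ k _ _ eq)) })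
            (1/[x^-1]-spec q m))

-- With a′ = a + 1 + d, equality would give q ∣ p (1 + d), hence q ∣ 1 + d by coprimality, although
-- 0 < 1 + d < q.
coefficient-unique : ∀ {p q a a′} b b′ → Coprime p q → a < a′ → a′ < q →
                     a′ ℕ.* p ℕ.+ b′ ℕ.* q ≢ a ℕ.* p ℕ.+ b ℕ.* q
coefficient-unique {p} {q} {a} b b′ coprime a<a′ a′<q eq with ℕ.m≤n⇒∃[o]m+o≡n a<a′
... | d , refl = >⇒∤ (ℕ.≤-<-trans (s≤s (ℕ.m≤n+m d a)) a′<q)
  (coprime-divisor (Coprimality.sym coprime)
    (∣m+n∣m⇒∣n (divides b (ℕ.+-cancelˡ-≡ (a ℕ.* p) _ _ (trans (regroup a d p (b′ ℕ.* q)) eq))) (n∣m*n b′)))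
  where
  regroup : ∀ a d p z → a ℕ.* p ℕ.+ (z ℕ.+ p ℕ.* suc d) ≡ (suc a ℕ.+ d) ℕ.* p ℕ.+ z
  regroup = ℕ-Solver.solve-∀

-- The summand added for a = m is supported on the m p + b q. As m < q, `coefficient-unique` keeps
-- these apart from the earlier exponents, so no coefficient drops below -1.
geometric-spec : ∀ {p q} → Coprime p q → ∀ {m} → m ≤ q → ∀ n →
                 geometric p q m n ≡−[ RepresentableBelow p q m n ]
geometric-spec         coprime {zero}  m≤q n = inj₂ ((λ { (_ , _ , () , _) }) , refl)
geometric-spec {p} {q} coprime {suc m} m<q n =
  ≡−[]-map to from (≡−[]-⊎ disjoint (shift-1/[x^-1]-spec q (m ℕ.* p) n)
                                     (geometric-spec coprime (ℕ.<⇒≤ m<q) n))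
  where
  Last = ∃ λ b → m ℕ.* p ℕ.+ b ℕ.* q ≡ n
  disjoint : ¬ (Last × RepresentableBelow p q m n)
  disjoint ((b′ , eq′) , (a , b , a<m , eq)) =
    coefficient-unique b b′ coprime a<m m<q (trans eq′ (sym eq))
  to : Last ⊎ RepresentableBelow p q m n → RepresentableBelow p q (suc m) n
  to (inj₁ (b , eq))           = m , b , ℕ.≤-refl , eq
  to (inj₂ (a , b , a<m , eq)) = a , b , ℕ.m<n⇒m<1+n a<m , eq
  from : RepresentableBelow p q (suc m) n → Last ⊎ RepresentableBelow p q m n
  from (a , b , a<1+m , eq) with ℕ.m≤n⇒m<n∨m≡n (ℕ.≤-pred a<1+m)
  ... | inj₁ a<m  = inj₂ (a , b , a<m , eq)
  ... | inj₂ refl = inj₁ (b , eq)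

-- Reduce a modulo q: since (k q) p = (k p) q, the quotient part of a moves into the coefficient of
-- q.
representable⇒below : ∀ {p q n} .{{_ : NonZero q}} → Representable p q n → RepresentableBelow p q q n
representable⇒below {p} {q} (a , b , refl) = a % q , a / q ℕ.* p ℕ.+ b , m%n<n a q ,
  trans (regroup (a % q) (a / q) p q b)
        (cong (λ i → i ℕ.* p ℕ.+ b ℕ.* q) (sym (m≡m%n+[m/n]*n a q)))
  where
  regroup : ∀ r k p q b → r ℕ.* p ℕ.+ (k ℕ.* p ℕ.+ b) ℕ.* q ≡ (r ℕ.+ k ℕ.* q) ℕ.* p ℕ.+ b ℕ.* q
  regroup = ℕ-Solver.solve-∀

-- The series −Σ x^s over the semigroup ⟨p , q⟩; the sign makes Q = (x − 1) times it.
semigroupSeries : (p q : ℕ) → ℕ → ℤ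
semigroupSeries p q = geometric p q q

semigroupSeries-spec : ∀ {p q} .{{_ : NonZero q}} → Coprime p q → ∀ n →
                       semigroupSeries p q n ≡−[ Representable p q n ]
semigroupSeries-spec coprime n =
  ≡−[]-map (λ { (a , b , _ , eq) → a , b , eq }) representable⇒below (geometric-spec coprime ℕ.≤-refl n)

-- This is the defining equation of Q for (x - 1) times the semigroup series. The factor x - 1 is
-- commuted outward, and the rest is `Δ-Δ-geometric` at m = q.
Δ-Δ-Δ-semigroupSeries : ∀ p q .{{_ : NonZero q}} →
  Δ q (Δ p (Δ 1 (semigroupSeries p q))) ≗ Δ 1 (Δ (p ℕ.* q) (coeff 𝟙))
Δ-Δ-Δ-semigroupSeries p q n = begin
  Δ q (Δ p (Δ 1 t)) n          ≡⟨ Δ-cong q (Δ-comm p 1 t) n ⟩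
  Δ q (Δ 1 (Δ p t)) n          ≡⟨ Δ-comm q 1 (Δ p t) n ⟩
  Δ 1 (Δ q (Δ p t)) n          ≡⟨ Δ-cong 1 (Δ-comm q p t) n ⟩
  Δ 1 (Δ p (Δ q t)) n          ≡⟨ Δ-cong 1 (Δ-Δ-geometric p q q) n ⟩
  Δ 1 (Δ (q ℕ.* p) δ) n        ≡⟨ cong (λ k → Δ 1 (Δ k δ) n) (ℕ.*-comm q p) ⟩
  Δ 1 (Δ (p ℕ.* q) δ) n        ∎
  where
  open ≡-Reasoning
  t = semigroupSeries p q
  δ = coeff 𝟙

-- Both series solve the same equation, from which x^q - 1 and x^p - 1 are cancelled in turn.
isBinaryInclusionExclusion⇒ : ∀ p q .{{_ : NonZero p}} .{{_ : NonZero q}} Q →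
  IsBinaryInclusionExclusion p q Q → coeff Q ≗ Δ 1 (semigroupSeries p q)
isBinaryInclusionExclusion⇒ p q Q isQ = Δ-injective p (Δ-injective q λ n → begin
  Δ q (Δ p (coeff Q)) n                    ≡⟨ isBinaryInclusionExclusion-lhs p q Q n ⟨
  _                                        ≡⟨ isQ n ⟩
  _                                        ≡⟨ isBinaryInclusionExclusion-rhs (p ℕ.* q) n ⟩
  Δ 1 (Δ (p ℕ.* q) (coeff 𝟙)) n            ≡⟨ Δ-Δ-Δ-semigroupSeries p q n ⟨
  Δ q (Δ p (Δ 1 (semigroupSeries p q))) n  ∎)
  where open ≡-Reasoning

⇒isBinaryInclusionExclusion : ∀ p q .{{_ : NonZero q}} Q →
  coeff Q ≗ Δ 1 (semigroupSeries p q) → IsBinaryInclusionExclusion p q Q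
⇒isBinaryInclusionExclusion p q Q Q≗ n = begin
  _                                        ≡⟨ isBinaryInclusionExclusion-lhs p q Q n ⟩
  Δ q (Δ p (coeff Q)) n                    ≡⟨ Δ-cong q (Δ-cong p Q≗) n ⟩
  Δ q (Δ p (Δ 1 (semigroupSeries p q))) n  ≡⟨ Δ-Δ-Δ-semigroupSeries p q n ⟩
  Δ 1 (Δ (p ℕ.* q) (coeff 𝟙)) n            ≡⟨ isBinaryInclusionExclusion-rhs (p ℕ.* q) n ⟨
  _                                        ∎
  where open ≡-Reasoning

-- The numerical semigroup ⟨p , q⟩

representable-0 : ∀ {p q} → Representable p q 0
representable-0 = 0 , 0 , refl

representable-+ : ∀ {p q m n} → Representable p q m → Representable p q n → Representable p q (m ℕ.+ n)
representable-+ {p} {q} (a , b , refl) (c , d , refl) = a ℕ.+ c , b ℕ.+ d , regroup a b c d p q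
  where
  regroup : ∀ a b c d p q → (a ℕ.+ c) ℕ.* p ℕ.+ (b ℕ.+ d) ℕ.* q ≡ (a ℕ.* p ℕ.+ b ℕ.* q) ℕ.+ (c ℕ.* p ℕ.+ d ℕ.* q)
  regroup = ℕ-Solver.solve-∀

representable-* : ∀ {p q n} k → Representable p q n → Representable p q (k ℕ.* n)
representable-* zero    n∈S = representable-0
representable-* (suc k) n∈S = representable-+ n∈S (representable-* k n∈S)

representable-*p : ∀ {p q} a → Representable p q (a ℕ.* p)
representable-*p a = a , 0 , ℕ.+-identityʳ _

representable-*q : ∀ {p q} b → Representable p q (b ℕ.* q)
representable-*q b = 0 , b , refl

representable-⊓ : ∀ p q → Representable p q (p ⊓ q)
representable-⊓ p q with ℕ.⊓-sel p q
... | inj₁ eq = subst (Representable p q) (trans (ℕ.*-identityˡ p) (sym eq)) (representable-*p 1)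
... | inj₂ eq = subst (Representable p q) (trans (ℕ.*-identityˡ q) (sym eq)) (representable-*q 1)

¬representable : ∀ {p q n} → 0 < n → n < p ⊓ q → ¬ Representable p q n
¬representable             () _   (zero , zero , refl)
¬representable {p} {q} _ n<p⊓q (suc a , b , refl) = ℕ.<⇒≱ n<p⊓q
  (ℕ.≤-trans (ℕ.m⊓n≤m p q) (ℕ.≤-trans (ℕ.m≤m+n p (a ℕ.* p)) (ℕ.m≤m+n _ (b ℕ.* q))))
¬representable {p} {q} _ n<p⊓q (zero , suc b , refl) = ℕ.<⇒≱ n<p⊓q
  (ℕ.≤-trans (ℕ.m⊓n≤n p q) (ℕ.m≤m+n q (b ℕ.* q)))

-- Bézout over ℕ yields a multiple of p and a multiple of q that differ by 1; which is larger
-- depends on the case.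
representable-consecutive : ∀ {p q} → Coprime p q →
                            ∃ λ u → Representable p q u × Representable p q (suc u)
representable-consecutive {p} {q} coprime with coprime-Bézout coprime
... | Bézout.+- x y eq = y ℕ.* q , representable-*q y , subst (Representable p q) (sym eq) (representable-*p x)
... | Bézout.-+ x y eq = x ℕ.* p , representable-*p x , subst (Representable p q) (sym eq) (representable-*q y)

-- From u and u + 1 in the semigroup, j (u + 1) + (d - j) u = j + d u, so N = d u works.
representable-run : ∀ {p q} → Coprime p q → ∀ d → ∃ λ N → ∀ {j} → j ≤ d → Representable p q (j ℕ.+ N)
representable-run {p} {q} coprime d with representable-consecutive coprime
... | u , u∈S , 1+u∈S = d ℕ.* u , λ {j} j≤d →
  subst (Representable p q)
    (trans (regroup j (d ∸ j) u) (cong (λ i → j ℕ.+ i ℕ.* u) (ℕ.m+[n∸m]≡n j≤d)))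
    (representable-+ (representable-* j 1+u∈S) (representable-* (d ∸ j) u∈S))
  where
  regroup : ∀ j k u → j ℕ.* suc u ℕ.+ k ℕ.* u ≡ j ℕ.+ (j ℕ.+ k) ℕ.* u
  regroup = ℕ-Solver.solve-∀

-- Sets closed under adding d + 1, and jumps of their indicators

module _ {S : ℕ → Set} {d : ℕ} (closed : ∀ {n} → S n → S (suc d ℕ.+ n)) where

  -- A window of d + 1 consecutive elements slides up by one: its new last element is the old first
  -- one plus d + 1.
  run⇒cofinite : ∀ {N} → (∀ {j} → j ≤ d → S (j ℕ.+ N)) → ∀ {n} → N ≤ n → S n
  run⇒cofinite {N} run {n} N≤n = subst S (ℕ.m∸n+n≡m N≤n) (shifted (n ∸ N) z≤n)
    where
    shifted : ∀ k {j} → j ≤ d → S (j ℕ.+ (k ℕ.+ N))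
    shifted zero            j≤d = run j≤d
    shifted (suc k) {j} j≤d with ℕ.m≤n⇒m<n∨m≡n j≤d
    ... | inj₁ j<d  = subst S (sym (ℕ.+-suc j (k ℕ.+ N))) (shifted k j<d)
    ... | inj₂ refl = subst S (sym (ℕ.+-suc j (k ℕ.+ N))) (closed (shifted k z≤n))

  -- When the window slides up, an element that drops out at the bottom re-enters at the top after
  -- adding d + 1.
  window-hits : S 0 → ∀ n → ∃ λ j → j ≤ d × S (j ℕ.+ n)
  window-hits 0∈S zero = 0 , z≤n , 0∈S
  window-hits 0∈S (suc n) with window-hits 0∈S n
  ... | zero  , _   , n∈S = d , ℕ.≤-refl , subst S (sym (ℕ.+-suc d n)) (closed n∈S)
  ... | suc j , j<d , s   = j , ℕ.<⇒≤ j<d , subst S (sym (ℕ.+-suc j n)) s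

-- `Δ 1 t (suc m)` is `t m - t (suc m)`, so each zero of it extends the constant stretch by one
-- place.
jump-or-constant : ∀ t n e → (∃ λ k → n < k × k ≤ e ℕ.+ n × Δ 1 t k ≢ 0ℤ) ⊎ (∀ {j} → j ≤ e → t (j ℕ.+ n) ≡ t n)
jump-or-constant t n zero = inj₂ λ { z≤n → refl }
jump-or-constant t n (suc e) with jump-or-constant t n e
... | inj₁ (k , n<k , k≤e+n , jump) = inj₁ (k , n<k , ℕ.m≤n⇒m≤1+n k≤e+n , jump)
... | inj₂ constant with Δ 1 t (suc e ℕ.+ n) ℤ.≟ 0ℤ
...   | no  jump = inj₁ (suc e ℕ.+ n , s≤s (ℕ.m≤n+m n e) , ℕ.≤-refl , jump)
...   | yes flat = inj₂ λ {j} j≤1+e → extend (ℕ.m≤n⇒m<n∨m≡n j≤1+e)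
  where
  extend : ∀ {j} → j < suc e ⊎ j ≡ suc e → t (j ℕ.+ n) ≡ t n
  extend (inj₁ (s≤s j≤e)) = constant j≤e
  extend (inj₂ refl)      = trans (sym (ℤ.i-j≡0⇒i≡j _ _ flat)) (constant ℕ.≤-refl)

module _ {S : ℕ → Set} {t : ℕ → ℤ} (spec : ∀ n → t n ≡−[ S n ])
         {d : ℕ} (closed : ∀ {n} → S n → S (suc d ℕ.+ n)) where

  -- Both terms of the difference are -1. The bound N < n is strict because the difference at n also
  -- reads t at n - 1.
  run⇒Δ≡0 : ∀ {N} → (∀ {j} → j ≤ d → S (j ℕ.+ N)) → ∀ {n} → N < n → Δ 1 t n ≡ 0ℤ
  run⇒Δ≡0 run {suc n} (s≤s N≤n) = cong₂ _-_
    (≡−[]-true (spec n) (run⇒cofinite {S = S} closed run N≤n))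
    (≡−[]-true (spec (suc n)) (run⇒cofinite {S = S} closed run (ℕ.m≤n⇒m≤1+n N≤n)))

  -- d + 1 consecutive integers meet S, so if t is constant on them then they all
  -- lie in S, and so does everything beyond them.
  next-jump : S 0 → ∀ {n m} → n < m → Δ 1 t m ≢ 0ℤ → ∃ λ k → n < k × k ≤ d ℕ.+ n × Δ 1 t k ≢ 0ℤ
  next-jump 0∈S {n} n<m jump with jump-or-constant t n d
  ... | inj₁ found = found
  ... | inj₂ constant with window-hits {S = S} closed 0∈S n
  ...   | i , i≤d , i+n∈S = contradiction (run⇒Δ≡0 run n<m) jump
    where
    run : ∀ {j} → j ≤ d → S (j ℕ.+ n)
    run {j} j≤d = ≡−[]-true⁻¹ (spec (j ℕ.+ n))
      (trans (constant j≤d) (trans (sym (constant i≤d)) (≡−[]-true (spec (i ℕ.+ n)) i+n∈S)))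

-- Gaps

coeff-applyUpTo : ∀ f N → (∀ {n} → N ≤ n → f n ≡ 0ℤ) → coeff (applyUpTo f N) ≗ f
coeff-applyUpTo f zero    f≡0 n       = sym (f≡0 z≤n)
coeff-applyUpTo f (suc N) f≡0 zero    = refl
coeff-applyUpTo f (suc N) f≡0 (suc n) = coeff-applyUpTo (f ∘ suc) N (f≡0 ∘ s≤s) n

coeff≢0⇒<length : ∀ f n → coeff f n ≢ 0ℤ → n < length f
coeff≢0⇒<length []      n       c≢0 = contradiction refl c≢0
coeff≢0⇒<length (a ∷ f) zero    c≢0 = s≤s z≤n
coeff≢0⇒<length (a ∷ f) (suc n) c≢0 = s≤s (coeff≢0⇒<length f n c≢0)

∈-exponents⁺ : ∀ f {n} → coeff f n ≢ 0ℤ → n ∈ exponents f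
∈-exponents⁺ f {n} c≢0 = ∈-filter⁺ (λ n → ¬? (coeff f n ℤ.≟ 0ℤ)) (∈-upTo⁺ (coeff≢0⇒<length f n c≢0)) c≢0

∈-exponents⁻ : ∀ f {n} → n ∈ exponents f → coeff f n ≢ 0ℤ
∈-exponents⁻ f n∈ = proj₂ (∈-filter⁻ (λ n → ¬? (coeff f n ℤ.≟ 0ℤ)) {xs = upTo (length f)} n∈)

exponents-sorted : ∀ f → AllPairs _<_ (exponents f)
exponents-sorted f = AllPairs.filter⁺ (λ n → ¬? (coeff f n ℤ.≟ 0ℤ))
  (AllPairs.applyUpTo⁺₁ id (length f) (λ i<j _ → i<j))

-- In a sorted list the successor of e is at most any entry k beyond e, so some k ≤ d + e bounds
-- that gap. The entry m records that n is not the last one.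
gaps-≤ : ∀ {d es} → AllPairs _<_ es →
         (∀ {n m} → n ∈ es → m ∈ es → n < m → ∃ λ k → n < k × k ≤ d ℕ.+ n × k ∈ es) →
         foldr _⊔_ 0 (gaps es) ≤ d
gaps-≤ {es = []}     sorted next = z≤n
gaps-≤ {es = e ∷ []} sorted next = z≤n
gaps-≤ {d} {e ∷ e′ ∷ es} ((e<e′ ∷ e<es) ∷ sorted@(e′<es ∷ _)) next =
  ℕ.⊔-lub first (gaps-≤ sorted next′)
  where
  first : e′ ∸ e ≤ d
  first with next (here refl) (there (here refl)) e<e′
  ... | k , e<k , _     , here refl          = contradiction e<k (ℕ.<-irrefl refl)
  ... | k , _   , k≤d+e , there (here refl)  = ℕ.m≤n+o⇒m∸n≤o _ e (subst (e′ ≤_) (ℕ.+-comm d e) k≤d+e)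
  ... | k , _   , k≤d+e , there (there k∈es) = ℕ.m≤n+o⇒m∸n≤o _ e
    (subst (e′ ≤_) (ℕ.+-comm d e) (ℕ.≤-trans (ℕ.<⇒≤ (All.lookup e′<es k∈es)) k≤d+e))
  next′ : ∀ {n m} → n ∈ e′ ∷ es → m ∈ e′ ∷ es → n < m → ∃ λ k → n < k × k ≤ d ℕ.+ n × k ∈ e′ ∷ es
  next′ n∈ m∈ n<m with next (there n∈) (there m∈) n<m
  -- The case k = e cannot occur: n lies in the tail, so e < n < k.
  ... | k , n<k , _     , here refl = contradiction n<k (ℕ.<-asym (All.lookup (e<e′ ∷ e<es) n∈))
  ... | k , n<k , k≤d+n , there k∈  = k , n<k , k≤d+n , k∈

-- The entry following n is already at least m, so the gap starting at n has length at least m - n.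
gaps-≥ : ∀ {es n m} → AllPairs _<_ es → n ∈ es → m ∈ es → n < m →
         (∀ {k} → k ∈ es → n < k → m ≤ k) → m ∸ n ≤ foldr _⊔_ 0 (gaps es)
gaps-≥ {e ∷ es} _ (here refl) (here refl) n<m gap = contradiction n<m (ℕ.<-irrefl refl)
gaps-≥ {n ∷ e′ ∷ es} ((n<e′ ∷ _) ∷ _) (here refl) (there m∈) n<m gap =
  ℕ.≤-trans (ℕ.∸-monoˡ-≤ n (gap (there (here refl)) n<e′)) (ℕ.m≤m⊔n (e′ ∸ n) _)
gaps-≥ (e<es ∷ _) (there n∈) (here refl) n<m gap = contradiction n<m (ℕ.<-asym (All.lookup e<es n∈))
gaps-≥ {e ∷ e′ ∷ es} (_ ∷ sorted) (there n∈) (there m∈) n<m gap =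
  ℕ.≤-trans (gaps-≥ sorted n∈ m∈ n<m (gap ∘ there)) (ℕ.m≤n⊔m (e′ ∸ e) _)

maxGap-≤ : ∀ f {d} → (∀ {n m} → n < m → coeff f m ≢ 0ℤ → ∃ λ k → n < k × k ≤ d ℕ.+ n × coeff f k ≢ 0ℤ) →
           maxGap f ≤ d
maxGap-≤ f next = gaps-≤ (exponents-sorted f) λ _ m∈ n<m →
  let k , n<k , k≤d+n , c≢0 = next n<m (∈-exponents⁻ f m∈)
  in k , n<k , k≤d+n , ∈-exponents⁺ f c≢0

maxGap-≥ : ∀ f {n m} → coeff f n ≢ 0ℤ → coeff f m ≢ 0ℤ → n < m →
           (∀ {k} → n < k → k < m → coeff f k ≡ 0ℤ) → m ∸ n ≤ maxGap f
maxGap-≥ f cn≢0 cm≢0 n<m gap =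
  gaps-≥ (exponents-sorted f) (∈-exponents⁺ f cn≢0) (∈-exponents⁺ f cm≢0) n<m
    λ k∈ n<k → ℕ.≮⇒≥ λ k<m → ∈-exponents⁻ f k∈ (gap n<k k<m)

module _ {S : ℕ → Set} {t : ℕ → ℤ} (spec : ∀ n → t n ≡−[ S n ])
         {d : ℕ} (0<d : 0 < d) (0∈S : S 0) (closed : ∀ {n} → S n → S (suc d ℕ.+ n))
         (∉S : ∀ {n} → 0 < n → n < suc d → ¬ S n) where

  -- The upper bound is `next-jump`. For the lower one, t is -1 at 0, vanishes on 1, ..., d and is
  -- -1 at d + 1, so the coefficients at 1 and d + 1 are -1 and 1, with zeros between; 0 < d makes
  -- these two exponents distinct.
  maxGap-Δ : ∀ f → coeff f ≗ Δ 1 t → maxGap f ≡ d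
  maxGap-Δ f f≗ = ℕ.≤-antisym
    (maxGap-≤ f λ n<m c≢0 →
      let k , n<k , k≤d+n , jump = next-jump spec closed 0∈S n<m (c≢0 ∘ trans (f≗ _))
      in k , n<k , k≤d+n , jump ∘ trans (sym (f≗ k)))
    (maxGap-≥ f coeff-1 coeff-1+d (s≤s 0<d) between)
    where
    t≡0 : ∀ {n} → 0 < n → n < suc d → t n ≡ 0ℤ
    t≡0 {n} 0<n n<1+d = ≡−[]-false (spec n) (∉S 0<n n<1+d)

    coeff-1 : coeff f 1 ≢ 0ℤ
    coeff-1 c≡0 with trans (sym (cong₂ _-_ (≡−[]-true (spec 0) 0∈S) (t≡0 (s≤s z≤n) (s≤s 0<d)))) (trans (sym (f≗ 1)) c≡0)
    ... | ()

    coeff-1+d : coeff f (suc d) ≢ 0ℤ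
    coeff-1+d c≡0 with trans (sym (cong₂ _-_ (t≡0 0<d ℕ.≤-refl)
      (≡−[]-true (spec (suc d)) (subst S (ℕ.+-identityʳ (suc d)) (closed 0∈S))))) (trans (sym (f≗ (suc d))) c≡0)
    ... | ()

    between : ∀ {k} → 1 < k → k < suc d → coeff f k ≡ 0ℤ
    between {suc k} (s≤s 0<k) 1+k<1+d = trans (f≗ (suc k))
      (cong₂ _-_ (t≡0 0<k (ℕ.<-trans ℕ.≤-refl 1+k<1+d)) (t≡0 (s≤s z≤n) 1+k<1+d))

theorem9 : (p q : ℕ) → 1 < p → 1 < q → Coprime p q →
    ∃ (IsBinaryInclusionExclusion p q) ×
    ((Q : ℤ[x]) → IsBinaryInclusionExclusion p q Q → maxGap Q ≡ p ⊓ q ∸ 1)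
theorem9 p@(suc (suc _)) q@(suc (suc _)) (s≤s (s≤s z≤n)) (s≤s (s≤s z≤n)) coprime =
  (Q₀ , ⇒isBinaryInclusionExclusion p q Q₀ Q₀≗Δt) ,
  -- Here d is `p ⊓ q ∸ 1`. As p and q are matched as double successors, `p ⊓ q` computes to `suc d`
  -- with d positive.
  λ Q isQ → maxGap-Δ spec (s≤s z≤n) representable-0 closed ¬representable Q
    (isBinaryInclusionExclusion⇒ p q Q isQ)
  where
  t = semigroupSeries p q
  spec = semigroupSeries-spec coprime
  closed : ∀ {n} → Representable p q n → Representable p q (p ⊓ q ℕ.+ n)
  closed = representable-+ (representable-⊓ p q)
  run = representable-run coprime (p ⊓ q ∸ 1)
  -- `Δ 1 t` vanishes beyond the start N of a run, so the coefficients at 0, ..., N, which are N + 1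
  -- in number, capture it all.
  Q₀ = applyUpTo (Δ 1 t) (suc (proj₁ run))
  Q₀≗Δt : coeff Q₀ ≗ Δ 1 t
  Q₀≗Δt = coeff-applyUpTo (Δ 1 t) (suc (proj₁ run)) (run⇒Δ≡0 spec closed (proj₂ run))
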